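{- Let $\mathcal{R}$ be a totally matching partial applicative structure such that there exists $r\in\mathcal{R}$ with $|\mathcal{R}^{\mathsf{Im}(r)}|>|\mathcal{R}|$. Then $(\mathcal{P}(\mathcal{R})^{\mathcal{R}},\vdash_{\mathcal{R}})$ is not complete.
   Context: A partial applicative structure is a non-empty set $\mathcal{R}$ together with a partial binary function $\cdot:\mathcal{R}\times\mathcal{R}\rightharpoonup\mathcal{R}$; $t\downarrow$ means that $t$ is defined. It is totally matching if for every $x,y\in\mathcal{R}$ there exists $r\in\mathcal{R}$ such that $r\cdot x\downarrow$ and $r\cdot x=y$. For $r\in\mathcal{R}$, $\mathsf{Im}(r):=\{r\cdot x\mid x\in\mathcal{R},\ r\cdot x\downarrow\}$. For sets $X,Y$, $Y^X$ is the set of functions from $X$ to $Y$. For $A,B\subseteq\mathcal{R}$ let $A\Rightarrow B:=\{r\in\mathcal{R}\mid \text{for every } a\in A,\ r\cdot a\downarrow \text{ and } r\cdot a\in B\}$. For $\varphi,\psi:\mathcal{R}\to\mathcal{P}(\mathcal{R})$, $\varphi\vdash_{\mathcal{R}}\psi$ means that $\bigcap_{x\in\mathcal{R}}(\varphi(x)\Rightarrow\psi(x))\neq\emptyset$. Given a binary relation $R$ on a set $A$ (not assumed to be a preorder) and a set-indexed family $(a_i)_{i\in I}$ of elements of $A$, an element $b\in A$ is a supremum for $(a_i)_{i\in I}$ if (a) $R(a_i,b)$ for every $i\in I$, and (b) whenever $c\in A$ satisfies $R(a_i,c)$ for every $i\in I$, then $R(b,c)$. The relation $R$ (or the pair $(A,R)$)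 is complete if every set-indexed family of elements of $A$ has a supremum. -}

module Defs where

open import Level using (Level; _⊔_; suc)
open import Data.Product.Base using (Σ-syntax; ∃-syntax; _×_)
open import Data.Refinement.Base using (Refinement)
open import Function.Definitions using (Injective)
open import Relation.Binary.Bundles using (Setoid)
open import Relation.Binary.Core using (Rel)
open import Relation.Binary.PropositionalEquality using (_≡_; _→-setoid_)
open import Relation.Nullary.Negation.Core using (¬_)
open import Relation.Unary using (Pred; _∈_; Satisfiable; ⋂)

private
  variable
    a b i ℓ ℓ₁ ℓ₂ : Level

-- The partial operation is given by its graph: r · x ↦ y reads
-- "r · x is defined and equal to y".  Subsets of the carrier are predicates in
-- the universe of the carrier.
record PartialApplicativeStructure (a : Level) : Set (suc a) where
  infix 4 _·_↦_ _·_∈↓_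
  infixr 5 _⇒_
  infix 4 _⊢_

  field
    Carrier    : Set a
    nonEmpty   : Carrier
    _·_↦_      : Carrier → Carrier → Carrier → Set a
    functional : ∀ {r x y z} → r · x ↦ y → r · x ↦ z → y ≡ z

  -- "r · x is defined and belongs to B".
  _·_∈↓_ : Carrier → Carrier → Pred Carrier a → Set a
  r · x ∈↓ B = ∃[ y ] (r · x ↦ y × y ∈ B)

  TotallyMatching : Set a
  TotallyMatching = ∀ x y → ∃[ r ] r · x ↦ y

  Im : Carrier → Pred Carrier a
  Im r y = ∃[ x ] r · x ↦ y

  _⇒_ : Pred Carrier a → Pred Carrier a → Pred Carrier a
  (A ⇒ B) r = ∀ x → x ∈ A → r · x ∈↓ B

  _⊢_ : Rel (Carrier → Pred Carrier a) a
  φ ⊢ ψ = Satisfiable (⋂ Carrier (λ x → φ x ⇒ ψ x))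

-- |A| ≤ |B|: there is a map reflecting equality.  Function sets carry pointwise
-- equality (see _^⟨_⟩ below).  Preservation of equality is not demanded of the
-- map: it is automatic for propositional equality, and for pointwise equality
-- it is exactly what function extensionality, not assumed here, would provide.
infix 4 _≲_ _≺_

_≲_ : Setoid a ℓ₁ → Setoid b ℓ₂ → Set (a ⊔ b ⊔ ℓ₁ ⊔ ℓ₂)
A ≲ B = Σ[ f ∈ (A.Carrier → B.Carrier) ] Injective A._≈_ B._≈_ f
  where
  module A = Setoid A
  module B = Setoid B

_≺_ : Setoid a ℓ₁ → Setoid b ℓ₂ → Set (a ⊔ b ⊔ ℓ₁ ⊔ ℓ₂)
A ≺ B = (A ≲ B) × ¬ (B ≲ A)

-- The set of functions to Y from the subset P of X, with pointwise equality.
-- Membership proofs in a Refinement are irrelevant, so elements of the subset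
-- are equal as soon as their values in X are, and a function cannot depend on
-- how membership is witnessed.
infixl 8 _^⟨_⟩

_^⟨_⟩ : {X : Set a} → Set b → Pred X ℓ → Setoid (a ⊔ b ⊔ ℓ) (a ⊔ b ⊔ ℓ)
_^⟨_⟩ {X = X} Y P = Refinement X P →-setoid Y

module _ {A : Set a} (R : Rel A ℓ) where

  record IsSupremum {I : Set i} (f : I → A) (s : A) : Set (a ⊔ i ⊔ ℓ) where
    field
      upperBound : ∀ j → R (f j) s
      least      : ∀ c → (∀ j → R (f j) c) → R s c

  -- Sets indexing families are the types in Set i.
  Complete : (i : Level) → Set (a ⊔ suc i ⊔ ℓ)
  Complete i = (I : Set i) (f : I → A) → ∃[ s ] IsSupremum f s

{-# OPTIONS --safe #-}

-- For a subset P of the carrier, consider the predicates "x = z" (realized by a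
-- fixed element only) for z in P.  By total matching, every c with c(z) inhabited
-- for all z in P is an upper bound.  Hence a supremum s entails the graph of each
-- function f on P, and since s(z) is inhabited for z in P, an element realizing
-- this entailment determines f.  So there are at most as many functions on P as
-- elements.
module Submission where

open import Level using (Level)
open import Data.Product.Base using (∃-syntax; _×_; _,_; proj₁; proj₂)
open import Data.Refinement.Base using (Refinement; value)
open import Relation.Binary.PropositionalEquality using (_≡_; refl; sym; trans; setoid)
open import Relation.Nullary.Negation.Core using (¬_)
open import Relation.Unary using (Pred; _∈_; Satisfiable)
open import Defs

module _ {a : Level} (𝓡 : PartialApplicativeStructure a) where
  open PartialApplicativeStructure 𝓡

  module _ (P : Pred Carrier a) where

    point : Refinement Carrier P → Carrier → Pred Carrier a
    point j x y = value j ≡ x × y ≡ nonEmpty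

    graph : (Refinement Carrier P → Carrier) → Carrier → Pred Carrier a
    graph f x y = ∃[ j ] (value j ≡ x × f j ≡ y)

    graph-functional : ∀ f j {y} → y ∈ graph f (value j) → f j ≡ y
    -- Membership proofs are irrelevant, so equating the values already identifies the two indices.
    graph-functional f j (_ , refl , fj≡y) = fj≡y

    point⊢graph : TotallyMatching → ∀ f j → point j ⊢ graph f
    -- Whatever `x` is, `nonEmpty` is the only input to handle.
    point⊢graph matching f j with matching nonEmpty (f j)
    ... | e , e↦fj = e , λ { x _ (j≡x , refl) → f j , e↦fj , j , j≡x , refl }

    -- A realizer of `point j ⊢ s` must send `nonEmpty` into `s (value j)`.
    upperBound-inhabited : ∀ {s} j → point j ⊢ s → Satisfiable (s (value j))
    upperBound-inhabited j (e , e⊩) with e⊩ (value j) nonEmpty (refl , refl)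
    ... | y , _ , y∈s = y , y∈s

    realizer-determines : ∀ {s} f g → (∀ j → Satisfiable (s (value j))) →
      (p : s ⊢ graph f) (q : s ⊢ graph g) → proj₁ p ≡ proj₁ q → ∀ j → f j ≡ g j
    realizer-determines f g inhabited (d , d⊩f) (_ , d⊩g) refl j
      with inhabited j
    -- The shared realizer `d` has one value at `b`, which both graphs must contain.
    ... | b , b∈s with d⊩f (value j) b b∈s | d⊩g (value j) b b∈s
    ... | _ , d↦y , y∈f | _ , d↦z , z∈g with functional d↦y d↦z
    ... | refl = trans (graph-functional f j y∈f) (sym (graph-functional g j z∈g))

    supremum⇒≲ : TotallyMatching → ∃[ s ] IsSupremum _⊢_ point s →
      Carrier ^⟨ P ⟩ ≲ setoid Carrier
    supremum⇒≲ matching (s , isSup) =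
      -- A function goes to the realizer that leastness of `s` yields for its graph.
      (λ f → proj₁ (s⊢graph f)) ,
      λ {f} {g} → realizer-determines f g inhabited (s⊢graph f) (s⊢graph g)
      where
      open IsSupremum isSup

      s⊢graph : ∀ f → s ⊢ graph f
      s⊢graph f = least (graph f) (point⊢graph matching f)

      inhabited : ∀ j → Satisfiable (s (value j))
      inhabited j = upperBound-inhabited {s} j (upperBound j)

theorem3p17 : ∀ {a : Level} (𝓡 : PartialApplicativeStructure a) →
    let open PartialApplicativeStructure 𝓡 in
    TotallyMatching →
    (∃[ r ] setoid Carrier ≺ Carrier ^⟨ Im r ⟩) →
    ¬ Complete _⊢_ a
theorem3p17 𝓡 matching (r , _ , ≴) complete =
  ≴ (supremum⇒≲ 𝓡 (Im r) matching (complete _ (point 𝓡 (Im r))))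
  where open PartialApplicativeStructure 𝓡
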